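{- Let $A$ be a finite set of colours and let $\Bbbk T_A$ be the Hopf algebra of rooted ordered $A$-coloured trees, with the concatenation multiplication and the pruning coproduct $\Delta$. Then the planted tall trees generate a Hopf subalgebra of $\Bbbk T_A$.
   Context: $\Bbbk$ is a field of characteristic zero. A rooted ordered tree is a finite rooted tree in which the children of every vertex are totally ordered. A rooted ordered coloured (ROC) tree over a finite set $A$ is a rooted ordered tree together with a function from its set of edges to $A$. $T_A$ is the set of ROC trees and $\Bbbk T_A$ is the $\Bbbk$-vector space with basis $T_A$, graded by the number of edges. The trivial tree $\bullet$ has only a root. A planted tree is a non-trivial tree whose root has exactly one child. Product (concatenation): $t\cdot s$ is obtained by identifying the roots of $t$ and $s$, placing the branches of $t$ to the left of those of $s$; the unit is $\bullet$. Pruning coproduct: an admissible subtree $t_s$ of $t$ is a rooted subtree (connected subgraph) containing the root of $t$ (the trivial tree and $t$ itself are allowed), with order and colours inherited. Removing $t_s$ from $t$ prunes a sequence $(t_1,\dots,t_m)$ of planted trees (the branches of $t$ attached to vertices of $t_s$ by edges not in $t_s$, each with its lowest edge), ordered by the order inherited from $t$ (left-to-right depth-first order); the complementary tree is $t_c=t_1\cdot\ldots\cdot t_m$. Then $\Delta(t)=\sum_{t_s} t_c\otimes t_s$, summed over all admissible subtrees $t_s$ of $t$. The counit is $\epsilon(\bullet)=1$ and $\epsilon(t)=0$ for $t\ne\bullet$. With these operations $\Bbbk T_A$ is a graded connected Hopf algebra (a known result of Foissy). For $a\in A$, $B_a^+(t)$ denotes the planted tree obtained by attaching the root of $t$ to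 a new root by an additional edge coloured $a$. A planted tall tree (ladder) is a tree of the form $(B_{a_k}^+\circ\dots\circ B_{a_1}^+)(\bullet)$ with $k\ge 1$ and $a_1,\dots,a_k\in A$. -}

module Defs where

open import Level using (Level; _⊔_)
open import Algebra.Apartness.Bundles using (HeytingField; HeytingCommutativeRing)
open import Algebra.Bundles using (CommutativeRing)
import Algebra.Module.Construct.TensorUnit as TensorUnit
import Algebra.Definitions.RawMonoid as RawMonoidDefinitions
open import Algebra.Module.Bundles using (Module)
open import Algebra.Module.Structures.Biased using (IsModuleFromLeft)
open import Algebra.Module.Morphism.Structures using (IsModuleHomomorphism)
open import Data.List.Base using (List; []; _∷_; _++_; map; foldr; cartesianProductWith)
open import Data.List.Membership.Propositional using (_∈_)
open import Data.List.Membership.Propositional.Properties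
  using (∈-map⁺; ∈-map⁻; ∈-cartesianProductWith⁺)
open import Data.List.Relation.Unary.All using (All; []; _∷_)
import Data.List.Relation.Unary.All as All
open import Data.List.Relation.Unary.Any using (here; there)
open import Data.List.Relation.Unary.Unique.Propositional using (Unique)
import Data.List.Relation.Unary.AllPairs as AllPairs
open import Data.List.Relation.Unary.Unique.Propositional.Properties
  using (map⁺; cartesianProductWith⁺)
open import Data.Nat.Base using (ℕ; suc)
open import Data.Product.Base using (_×_; _,_; ∃; ∃₂)
open import Function.Base using (id)
open import Relation.Binary.PropositionalEquality using (_≡_; refl; _≢_)
open import Relation.Nullary.Negation using (¬_)
open import Relation.Unary using (Pred)

private
  variable
    a x : Level

fieldRing : ∀ {c ℓ₁ ℓ₂} → HeytingField c ℓ₁ ℓ₂ → CommutativeRing c ℓ₁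
fieldRing K = HeytingCommutativeRing.commutativeRing (HeytingField.heytingCommutativeRing K)

CharacteristicZero : ∀ {c ℓ₁ ℓ₂} → HeytingField c ℓ₁ ℓ₂ → Set ℓ₁
CharacteristicZero K = ∀ (n : ℕ) → ¬ (suc n ×′ 1# ≈ 0#)
  where
  open CommutativeRing (fieldRing K) using (_≈_; 0#; 1#; +-rawMonoid)
  open RawMonoidDefinitions +-rawMonoid using () renaming (_×_ to _×′_)

-- The list holds the branches at the root from left to right, each with the
-- colour of its lowest edge.
data Tree (A : Set a) : Set a where
  node : List (A × Tree A) → Tree A

• : {A : Set a} → Tree A
• = node []

B⁺ : {A : Set a} → A → Tree A → Tree A
B⁺ c t = node ((c , t) ∷ [])

infixr 7 _·_

_·_ : {A : Set a} → Tree A → Tree A → Tree A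
node bs · node cs = node (bs ++ cs)

data PlantedTall {A : Set a} : Tree A → Set a where
  edge : ∀ c → PlantedTall (B⁺ c •)
  grow : ∀ c {t} → PlantedTall t → PlantedTall (B⁺ c t)

-- A rooted subtree containing the root is given by deciding, for each branch at
-- the root, whether its lowest edge is absent or present, and in the latter case
-- choosing such a subtree of the tree above that edge.
mutual
  data AdmissibleSubtree {A : Set a} : Tree A → Set a where
    node : ∀ {bs} → All Choice bs → AdmissibleSubtree (node bs)

  data Choice {A : Set a} : A × Tree A → Set a where
    prune : ∀ {b} → Choice b
    keep  : ∀ {c t} → AdmissibleSubtree t → Choice (c , t)

module _ {A : Set a} where

  mutual
    subtree : {t : Tree A} → AdmissibleSubtree t → Tree A
    subtree (node ps) = node (keptBranches ps)

    keptBranches : {bs : List (A × Tree A)} → All Choice bs → List (A × Tree A)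
    keptBranches []                       = []
    keptBranches (prune ∷ ps)             = keptBranches ps
    keptBranches (keep {c = c} p ∷ ps)    = (c , subtree p) ∷ keptBranches ps

  mutual
    pruned : {t : Tree A} → AdmissibleSubtree t → List (Tree A)
    pruned (node ps) = prunedBranches ps

    prunedBranches : {bs : List (A × Tree A)} → All Choice bs → List (Tree A)
    prunedBranches []                          = []
    prunedBranches (prune {b = c , t} ∷ ps)    = B⁺ c t ∷ prunedBranches ps
    prunedBranches (keep p ∷ ps)               = pruned p ++ prunedBranches ps

  complement : {t : Tree A} → AdmissibleSubtree t → Tree A
  complement p = foldr _·_ • (pruned p)

  mutual
    admissibleSubtrees : (t : Tree A) → List (AdmissibleSubtree t)
    admissibleSubtrees (node bs) = map node (allChoices bs)

    allChoices : (bs : List (A × Tree A)) → List (All Choice bs)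
    allChoices []             = [] ∷ []
    allChoices ((c , t) ∷ bs) =
      cartesianProductWith _∷_ (prune ∷ map keep (admissibleSubtrees t)) (allChoices bs)

  mutual
    admissibleSubtrees-complete : {t : Tree A} (p : AdmissibleSubtree t) →
                                  p ∈ admissibleSubtrees t
    admissibleSubtrees-complete (node ps) = ∈-map⁺ node (allChoices-complete ps)

    allChoices-complete : {bs : List (A × Tree A)} (ps : All Choice bs) →
                          ps ∈ allChoices bs
    allChoices-complete []            = here refl
    allChoices-complete {(c , t) ∷ bs} (prune ∷ ps)  =
      ∈-cartesianProductWith⁺ _∷_ {xs = prune ∷ map keep (admissibleSubtrees t)}
        (here refl) (allChoices-complete ps)
    allChoices-complete {(c , t) ∷ bs} (keep p ∷ ps) =
      ∈-cartesianProductWith⁺ _∷_ {xs = prune ∷ map keep (admissibleSubtrees t)}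
        (there (∈-map⁺ keep (admissibleSubtrees-complete p))) (allChoices-complete ps)

  mutual
    admissibleSubtrees-unique : (t : Tree A) → Unique (admissibleSubtrees t)
    admissibleSubtrees-unique (node bs) =
      map⁺ (λ { refl → refl }) (allChoices-unique bs)

    allChoices-unique : (bs : List (A × Tree A)) → Unique (allChoices bs)
    allChoices-unique []             = [] AllPairs.∷ AllPairs.[]
    allChoices-unique ((c , t) ∷ bs) =
      cartesianProductWith⁺ _∷_ (λ { refl → refl , refl })
        (All.tabulate (λ q∈ → prune≢ (∈-map⁻ keep q∈)) AllPairs.∷
         map⁺ (λ { refl → refl }) (admissibleSubtrees-unique t))
        (allChoices-unique bs)
      where
      prune≢ : {q : Choice (c , t)} → (∃ λ p → p ∈ admissibleSubtrees t × q ≡ keep p) →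
               prune ≢ q
      prune≢ (_ , _ , refl) ()

module Linear {r ℓ} (R : CommutativeRing r ℓ) where

  open CommutativeRing R
    using (_≈_; 0#; 1#; -_)
    renaming (Carrier to Scalar; _+_ to _+ₛ_; _*_ to _*ₛ_)
  module R = CommutativeRing R

  infixl 6 _+_
  infixr 7 _*_
  infix  4 _∼_

  -- Formal linear combinations of elements of X; two of them are identified
  -- exactly when the module axioms force them to be equal.
  data Lin (X : Set x) : Set (r ⊔ x) where
    [_] : X → Lin X
    𝟎   : Lin X
    _+_ : Lin X → Lin X → Lin X
    _*_ : Scalar → Lin X → Lin X

  data _∼_ {X : Set x} : Lin X → Lin X → Set (r ⊔ ℓ ⊔ x) where
    ∼-refl      : ∀ {u} → u ∼ u
    ∼-sym       : ∀ {u v} → u ∼ v → v ∼ u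
    ∼-trans     : ∀ {u v w} → u ∼ v → v ∼ w → u ∼ w
    +-cong      : ∀ {u u′ v v′} → u ∼ u′ → v ∼ v′ → u + v ∼ u′ + v′
    *-cong      : ∀ {k k′ u u′} → k ≈ k′ → u ∼ u′ → k * u ∼ k′ * u′
    +-assoc     : ∀ u v w → (u + v) + w ∼ u + (v + w)
    +-comm      : ∀ u v → u + v ∼ v + u
    +-identityˡ : ∀ u → 𝟎 + u ∼ u
    *-distribˡ  : ∀ k u v → k * (u + v) ∼ k * u + k * v
    *-distribʳ  : ∀ u k l → (k +ₛ l) * u ∼ k * u + l * u
    *-assoc     : ∀ k l u → (k *ₛ l) * u ∼ k * (l * u)
    *-identityˡ : ∀ u → 1# * u ∼ u
    *-zeroˡ     : ∀ u → 0# * u ∼ 𝟎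

  *-zeroʳ : {X : Set x} (k : Scalar) → k * 𝟎 {X = X} ∼ 𝟎
  *-zeroʳ k =
    ∼-trans (*-cong R.refl (∼-sym (*-zeroˡ 𝟎)))
    (∼-trans (∼-sym (*-assoc k 0# 𝟎))
    (∼-trans (*-cong (R.zeroʳ k) ∼-refl) (*-zeroˡ 𝟎)))

  +-inverseʳ : {X : Set x} (u : Lin X) → u + (- 1#) * u ∼ 𝟎
  +-inverseʳ u =
    ∼-trans (+-cong (∼-sym (*-identityˡ u)) ∼-refl)
    (∼-trans (∼-sym (*-distribʳ u 1# (- 1#)))
    (∼-trans (*-cong (R.-‿inverseʳ 1#) ∼-refl) (*-zeroˡ u)))

  Free : Set x → Module R (r ⊔ x) (r ⊔ ℓ ⊔ x)
  Free X = record
    { Carrierᴹ = Lin X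
    ; _≈ᴹ_     = _∼_
    ; _+ᴹ_     = _+_
    ; _*ₗ_     = _*_
    ; _*ᵣ_     = λ u k → k * u
    ; 0ᴹ       = 𝟎
    ; -ᴹ_      = λ u → (- 1#) * u
    ; isModule = IsModuleFromLeft.isModule {commutativeRing = R} record
      { isLeftModule = record
        { isLeftSemimodule = record
          { +ᴹ-isCommutativeMonoid = record
            { isMonoid = record
              { isSemigroup = record
                { isMagma = record
                  { isEquivalence = record
                    { refl = ∼-refl ; sym = ∼-sym ; trans = ∼-trans }
                  ; ∙-cong = +-cong
                  }
                ; assoc = +-assoc
                }
              ; identity = +-identityˡ
                         , λ u → ∼-trans (+-comm u 𝟎) (+-identityˡ u)
              }
            ; comm = +-comm
            }
          ; isPreleftSemimodule = record
            { *ₗ-cong      = *-cong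
            ; *ₗ-zeroˡ     = *-zeroˡ
            ; *ₗ-distribʳ  = *-distribʳ
            ; *ₗ-identityˡ = *-identityˡ
            ; *ₗ-assoc     = *-assoc
            ; *ₗ-zeroʳ     = *-zeroʳ
            ; *ₗ-distribˡ  = *-distribˡ
            }
          }
        ; -ᴹ‿cong    = *-cong R.refl
        ; -ᴹ‿inverse = (λ u → ∼-trans (+-comm ((- 1#) * u) u) (+-inverseʳ u))
                     , +-inverseʳ
        }
      }
    }

  module _ {m ℓm} (M : Module R m ℓm) where

    open Module M

    extend : {X : Set x} → (X → Carrierᴹ) → Lin X → Carrierᴹ
    extend f [ i ]   = f i
    extend f 𝟎       = 0ᴹ
    extend f (u + v) = extend f u +ᴹ extend f v
    extend f (k * u) = k *ₗ extend f u

    extend-cong : {X : Set x} (f : X → Carrierᴹ) {u v : Lin X} →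
                  u ∼ v → extend f u ≈ᴹ extend f v
    extend-cong f ∼-refl              = ≈ᴹ-refl
    extend-cong f (∼-sym p)           = ≈ᴹ-sym (extend-cong f p)
    extend-cong f (∼-trans p q)       = ≈ᴹ-trans (extend-cong f p) (extend-cong f q)
    extend-cong f (+-cong p q)        = +ᴹ-cong (extend-cong f p) (extend-cong f q)
    extend-cong f (*-cong k≈ p)       = *ₗ-cong k≈ (extend-cong f p)
    extend-cong f (+-assoc u v w)     = +ᴹ-assoc _ _ _
    extend-cong f (+-comm u v)        = +ᴹ-comm _ _
    extend-cong f (+-identityˡ u)     = +ᴹ-identityˡ _
    extend-cong f (*-distribˡ k u v)  = *ₗ-distribˡ k _ _
    extend-cong f (*-distribʳ u k l)  = *ₗ-distribʳ _ k l
    extend-cong f (*-assoc k l u)     = *ₗ-assoc k l _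
    extend-cong f (*-identityˡ u)     = *ₗ-identityˡ _
    extend-cong f (*-zeroˡ u)         = *ₗ-zeroˡ _

    record IsSubmodule {p} (P : Pred Carrierᴹ p) : Set (r ⊔ m ⊔ ℓm ⊔ p) where
      field
        resp      : ∀ {u v} → u ≈ᴹ v → P u → P v
        0-closed  : P 0ᴹ
        +-closed  : ∀ {u v} → P u → P v → P (u +ᴹ v)
        *ₗ-closed : ∀ k {u} → P u → P (k *ₗ u)

    data Span {p} (G : Pred Carrierᴹ p) : Pred Carrierᴹ (r ⊔ m ⊔ ℓm ⊔ p) where
      gen       : ∀ {u} → G u → Span G u
      resp      : ∀ {u v} → u ≈ᴹ v → Span G u → Span G v
      0-closed  : Span G 0ᴹ
      +-closed  : ∀ {u v} → Span G u → Span G v → Span G (u +ᴹ v)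
      *ₗ-closed : ∀ k {u} → Span G u → Span G (k *ₗ u)

module TreeHopfAlgebra {c ℓ₁ ℓ₂} (K : HeytingField c ℓ₁ ℓ₂) (A : Set a) where

  𝕜 : CommutativeRing c ℓ₁
  𝕜 = fieldRing K

  open CommutativeRing 𝕜 using (0#; 1#) renaming (Carrier to Scalar)
  open Linear 𝕜 using (Lin; [_]; Free; extend; IsSubmodule; Span)

  H : Module 𝕜 (c ⊔ a) (c ⊔ ℓ₁ ⊔ a)
  H = Free (Tree A)

  -- The tensor square of a free module is free on pairs of basis elements.
  H⊗H : Module 𝕜 (c ⊔ a) (c ⊔ ℓ₁ ⊔ a)
  H⊗H = Free (Tree A × Tree A)

  open Module H   using () renaming
    (Carrierᴹ to 𝕜T; _≈ᴹ_ to _≈_; _+ᴹ_ to _+_; _*ₗ_ to _*ₗ_; 0ᴹ to 𝟎; rawModule to rawH)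
  open Module H⊗H using () renaming
    (Carrierᴹ to 𝕜T⊗𝕜T; _≈ᴹ_ to _≈⊗_; _+ᴹ_ to _+⊗_; 0ᴹ to 𝟎⊗)

  infixr 8 _⊗_
  infixl 7 _∙_

  _⊗_ : 𝕜T → 𝕜T → 𝕜T⊗𝕜T
  u ⊗ v = extend H⊗H (λ s → extend H⊗H (λ t → [ s , t ]) v) u

  map⊗ : (𝕜T → 𝕜T) → (𝕜T → 𝕜T) → 𝕜T⊗𝕜T → 𝕜T⊗𝕜T
  map⊗ f g = extend H⊗H (λ { (s , t) → f [ s ] ⊗ g [ t ] })

  μ : 𝕜T⊗𝕜T → 𝕜T
  μ = extend H (λ { (s , t) → [ s · t ] })

  _∙_ : 𝕜T → 𝕜T → 𝕜T
  u ∙ v = μ (u ⊗ v)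

  𝟏 : 𝕜T
  𝟏 = [ • ]

  Δ : 𝕜T → 𝕜T⊗𝕜T
  Δ = extend H⊗H (λ t →
        foldr (λ p w → [ complement p , subtree p ] +⊗ w) 𝟎⊗ (admissibleSubtrees t))

  ε : 𝕜T → Scalar
  ε = extend TensorUnit.⟨module⟩ (λ { (node []) → 1# ; (node (_ ∷ _)) → 0# })

  record IsAntipode (S : 𝕜T → 𝕜T) : Set (c ⊔ ℓ₁ ⊔ a) where
    field
      isModuleHomomorphism : IsModuleHomomorphism rawH rawH S
      inverseˡ             : ∀ u → μ (map⊗ S id (Δ u)) ≈ ε u *ₗ 𝟏
      inverseʳ             : ∀ u → μ (map⊗ id S (Δ u)) ≈ ε u *ₗ 𝟏

  -- The image of P ⊗ P in the tensor square.
  TensorSquare : ∀ {p} → Pred 𝕜T p → Pred 𝕜T⊗𝕜T (c ⊔ ℓ₁ ⊔ a ⊔ p)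
  TensorSquare P = Span H⊗H (λ w → ∃₂ λ u v → P u × P v × w ≡ u ⊗ v)

  -- Convolution inverses are unique, so the S in S-closed is the antipode.
  record IsHopfSubalgebra {p} (P : Pred 𝕜T p) : Set (c ⊔ ℓ₁ ⊔ a ⊔ p) where
    field
      isSubmodule : IsSubmodule H P
      1-closed    : P 𝟏
      ∙-closed    : ∀ {u v} → P u → P v → P (u ∙ v)
      Δ-closed    : ∀ {u} → P u → TensorSquare P (Δ u)
      S-closed    : ∀ {S} → IsAntipode S → ∀ {u} → P u → P (S u)

  data GeneratedSubalgebra {p} (G : Pred 𝕜T p) : Pred 𝕜T (c ⊔ ℓ₁ ⊔ a ⊔ p) where
    gen       : ∀ {u} → G u → GeneratedSubalgebra G u
    resp      : ∀ {u v} → u ≈ v → GeneratedSubalgebra G u → GeneratedSubalgebra G v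
    0-closed  : GeneratedSubalgebra G 𝟎
    +-closed  : ∀ {u v} → GeneratedSubalgebra G u → GeneratedSubalgebra G v →
                GeneratedSubalgebra G (u + v)
    *ₗ-closed : ∀ k {u} → GeneratedSubalgebra G u → GeneratedSubalgebra G (k *ₗ u)
    1-closed  : GeneratedSubalgebra G 𝟏
    ∙-closed  : ∀ {u v} → GeneratedSubalgebra G u → GeneratedSubalgebra G v →
                GeneratedSubalgebra G (u ∙ v)

  PlantedTallElement : Pred 𝕜T (c ⊔ a)
  PlantedTallElement u = ∃ λ t → PlantedTall t × u ≡ [ t ]

{-# OPTIONS --safe #-}

-- The subalgebra generated by the ladders is spanned by the concatenations of
-- ladders. An admissible subtree of such a concatenation, and the complement of
-- that subtree, are again concatenations of ladders, whence closure under Δ. The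
-- trivial subtree contributes t ⊗ • to Δ(t), so the left antipode identity reads
-- S(t) = ε(t) 1 − Σ S(t_c) t_s over the non-trivial t_s; every t_c occurring
-- there has fewer edges than t, and closure under S follows by induction on edges.

module Submission where

open import Defs
open import Algebra.Apartness.Bundles using (HeytingField)
open import Algebra.Bundles using (CommutativeRing)
open import Algebra.Module.Bundles using (Module)
open import Algebra.Module.Morphism.Structures using (IsModuleHomomorphism)
open import Data.Fin.Base using (Fin)
open import Data.List.Base using (List; []; _∷_; _++_; foldr)
open import Data.List.Properties using (++-identityʳ)
open import Data.List.Relation.Unary.All using (All; []; _∷_)
import Data.List.Relation.Unary.All as All
open import Data.List.Relation.Unary.All.Properties using (++⁺)
import Data.List.Relation.Unary.AllPairs as AllPairs
open import Data.Nat.Base using (ℕ; suc; _+_; _≤_; _<_; z≤n; s≤s)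
open import Data.Nat.Induction using (Acc; acc; <-wellFounded)
open import Data.Nat.Properties
  using (+-assoc; +-mono-≤; +-monoʳ-≤; +-monoʳ-<; m≤n⇒m≤1+n)
open import Data.Product.Base using (_×_; _,_; ∃; proj₂)
open import Function.Base using (id; _∘_)
open import Function.Bundles using (_↔_)
open import Level using (Level)
open import Relation.Binary.PropositionalEquality
  using (_≡_; _≢_; refl; sym; trans; cong; cong₂)
open import Relation.Nullary.Negation using (contradiction)
open import Relation.Unary using (Pred)

private
  variable
    a : Level

-- Concatenations of ladders and their admissible subtrees.

module _ {A : Set a} where

  -- Unlike `PlantedTall`, this class contains `•`: pruning a ladder can leave the trivial tree, and
  -- nothing but `•` lies above the edge of a one-edge ladder.
  data Tall : Pred (Tree A) a where
    trivial : Tall •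
    grow    : ∀ c {t} → Tall t → Tall (B⁺ c t)

  -- The condition falls on what lies above each root edge, so that each branch together with its
  -- lowest edge is a ladder.
  data TallForest : Pred (Tree A) a where
    node : ∀ {bs} → All (Tall ∘ proj₂) bs → TallForest (node bs)

  B⁺-plantedTall : ∀ c {t} → Tall t → PlantedTall (B⁺ c t)
  B⁺-plantedTall c trivial    = edge c
  B⁺-plantedTall c (grow d h) = grow c (B⁺-plantedTall d h)

  plantedTall⇒tall : ∀ {t} → PlantedTall t → Tall t
  plantedTall⇒tall (edge c)   = grow c trivial
  plantedTall⇒tall (grow c h) = grow c (plantedTall⇒tall h)

  tall⇒tallForest : ∀ {t} → Tall t → TallForest t
  tall⇒tallForest trivial    = node []
  tall⇒tallForest (grow _ h) = node (h ∷ [])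

  ·-tallForest : ∀ {s t} → TallForest s → TallForest t → TallForest (s · t)
  ·-tallForest (node hs) (node ks) = node (++⁺ hs ks)

  product-tallForest : ∀ {ts} → All TallForest ts → TallForest (foldr _·_ • ts)
  product-tallForest []       = node []
  product-tallForest (h ∷ hs) = ·-tallForest h (product-tallForest hs)

  subtree-tall : ∀ {t} → Tall t → (p : AdmissibleSubtree t) → Tall (subtree p)
  subtree-tall trivial    (node [])           = trivial
  subtree-tall (grow c h) (node (prune ∷ [])) = trivial
  subtree-tall (grow c h) (node (keep p ∷ [])) = grow c (subtree-tall h p)

  keptBranches-tall : ∀ {bs : List (A × Tree A)} → All (Tall ∘ proj₂) bs → (ps : All Choice bs) →
                      All (Tall ∘ proj₂) (keptBranches ps)
  keptBranches-tall []       []            = []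
  keptBranches-tall (h ∷ hs) (prune ∷ ps)  = keptBranches-tall hs ps
  keptBranches-tall (h ∷ hs) (keep p ∷ ps) = subtree-tall h p ∷ keptBranches-tall hs ps

  subtree-tallForest : ∀ {t} → TallForest t → (p : AdmissibleSubtree t) → TallForest (subtree p)
  subtree-tallForest (node hs) (node ps) = node (keptBranches-tall hs ps)

  mutual
    pruned-tallForest : ∀ {t} → TallForest t → (p : AdmissibleSubtree t) →
                        All TallForest (pruned p)
    pruned-tallForest (node hs) (node ps) = prunedBranches-tallForest hs ps

    prunedBranches-tallForest : ∀ {bs} → All (Tall ∘ proj₂) bs → (ps : All Choice bs) →
                                All TallForest (prunedBranches ps)
    prunedBranches-tallForest []       []            = []
    prunedBranches-tallForest (h ∷ hs) (prune ∷ ps)  =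
      node (h ∷ []) ∷ prunedBranches-tallForest hs ps
    prunedBranches-tallForest (h ∷ hs) (keep p ∷ ps) =
      -- What lies above a kept edge is a forest of at most one ladder; the recursion descends on
      -- `p`.
      ++⁺ (pruned-tallForest (tall⇒tallForest h) p) (prunedBranches-tallForest hs ps)

  complement-tallForest : ∀ {t} → TallForest t → (p : AdmissibleSubtree t) →
                          TallForest (complement p)
  complement-tallForest h p = product-tallForest (pruned-tallForest h p)

  ·-identityʳ : (t : Tree A) → t · • ≡ t
  ·-identityʳ (node bs) = cong node (++-identityʳ bs)

  -- Edge counts of complements.

  mutual
    edges : Tree A → ℕ
    edges (node bs) = edgesOf bs

    edgesOf : List (A × Tree A) → ℕ
    edgesOf []             = 0
    edgesOf ((_ , t) ∷ bs) = suc (edges t + edgesOf bs)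

  edgesOf-++ : ∀ bs cs → edgesOf (bs ++ cs) ≡ edgesOf bs + edgesOf cs
  edgesOf-++ []             cs = refl
  edgesOf-++ ((_ , t) ∷ bs) cs = cong suc
    (trans (cong (edges t +_) (edgesOf-++ bs cs)) (sym (+-assoc (edges t) _ _)))

  edges-· : ∀ s t → edges (s · t) ≡ edges s + edges t
  edges-· (node bs) (node cs) = edgesOf-++ bs cs

  edges-product-++ : ∀ ss ts → edges (foldr _·_ • (ss ++ ts)) ≡
                     edges (foldr _·_ • ss) + edges (foldr _·_ • ts)
  edges-product-++ []       ts = refl
  edges-product-++ (s ∷ ss) ts
    rewrite edges-· s (foldr _·_ • (ss ++ ts)) | edges-· s (foldr _·_ • ss)
          | edges-product-++ ss ts = sym (+-assoc (edges s) _ _)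

  edges-B⁺-· : ∀ c s t → edges (B⁺ c s · t) ≡ suc (edges s + edges t)
  edges-B⁺-· c s (node _) = refl

  mutual
    -- The pruned branches occupy disjoint sets of edges of `t`.
    complement-≤ : ∀ {t} (p : AdmissibleSubtree t) → edges (complement p) ≤ edges t
    complement-≤ (node ps) = prunedBranches-≤ ps

    prunedBranches-≤ : ∀ {bs} (ps : All Choice bs) →
                       edges (foldr _·_ • (prunedBranches ps)) ≤ edgesOf bs
    prunedBranches-≤ [] = z≤n
    prunedBranches-≤ (prune {b = c , t} ∷ ps)
      rewrite edges-B⁺-· c t (foldr _·_ • (prunedBranches ps)) =
      s≤s (+-monoʳ-≤ (edges t) (prunedBranches-≤ ps))
    prunedBranches-≤ (keep p ∷ ps) = m≤n⇒m≤1+n (keep-≤ p ps)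

    -- The kept edge below `t` is left out of the bound; this spare edge yields the strict
    -- inequality in `prunedBranches-<`.
    keep-≤ : ∀ {t bs} (p : AdmissibleSubtree t) (ps : All Choice bs) →
             edges (foldr _·_ • (pruned p ++ prunedBranches ps)) ≤ edges t + edgesOf bs
    keep-≤ p ps rewrite edges-product-++ (pruned p) (prunedBranches ps) =
      +-mono-≤ (complement-≤ p) (prunedBranches-≤ ps)

  -- The trivial subtree and its place in the enumeration.

  pruneAll : (bs : List (A × Tree A)) → All Choice bs
  pruneAll = All.universal (λ _ → prune)

  trivialSubtree : (t : Tree A) → AdmissibleSubtree t
  trivialSubtree (node bs) = node (pruneAll bs)

  -- Choices other than `pruneAll` keep some root edge, and that edge is missing from the
  -- complement.
  prunedBranches-< : ∀ {bs} (ps : All Choice bs) → pruneAll bs ≢ ps →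
                     edges (foldr _·_ • (prunedBranches ps)) < edgesOf bs
  prunedBranches-< [] ≢ = contradiction refl ≢
  prunedBranches-< (prune {b = c , t} ∷ ps) ≢
    rewrite edges-B⁺-· c t (foldr _·_ • (prunedBranches ps)) =
    -- The first branch adds the same number to both sides, so strictness must come from the later
    -- choices. These differ from `pruneAll`, as the first choice does not.
    s≤s (+-monoʳ-< (edges t) (prunedBranches-< ps (≢ ∘ cong (prune ∷_))))
  prunedBranches-< (keep p ∷ ps) ≢ = s≤s (keep-≤ p ps)

  complement-< : ∀ {t} (p : AdmissibleSubtree t) → trivialSubtree t ≢ p →
                 edges (complement p) < edges t
  complement-< (node ps) ≢ = prunedBranches-< ps (≢ ∘ cong node)

  subtree-trivialSubtree : ∀ t → subtree (trivialSubtree t) ≡ •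
  subtree-trivialSubtree (node bs) = cong node (kept bs)
    where
    kept : ∀ bs → keptBranches (pruneAll bs) ≡ []
    kept []       = refl
    kept (_ ∷ bs) = kept bs

  complement-trivialSubtree : ∀ t → complement (trivialSubtree t) ≡ t
  complement-trivialSubtree (node bs) = cut bs
    where
    cut : ∀ bs → foldr _·_ • (prunedBranches (pruneAll bs)) ≡ node bs
    cut []             = refl
    cut ((c , t) ∷ bs) = cong (B⁺ c t ·_) (cut bs)

  -- `allChoices` tries `prune` before `keep` at every branch, so its first entry prunes everywhere.
  -- Hence the term `t ⊗ •` stands first in the sum defining `Δ`.
  allChoices-head : ∀ bs → ∃ λ qs → allChoices bs ≡ pruneAll bs ∷ qs
  allChoices-head []       = _ , refl
  allChoices-head (_ ∷ bs) with allChoices bs | allChoices-head bs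
  ... | _ | _ , refl = _ , refl

  admissibleSubtrees-head : ∀ t → ∃ λ ps → admissibleSubtrees t ≡ trivialSubtree t ∷ ps
  admissibleSubtrees-head (node bs) with allChoices bs | allChoices-head bs
  ... | _ | _ , refl = _ , refl

-- The generated subalgebra as a span of basis trees.

module _ {c ℓ₁ ℓ₂} (K : HeytingField c ℓ₁ ℓ₂) (A : Set a) where

  open TreeHopfAlgebra K A
  open Linear 𝕜 using ([_]; 𝟎; extend-cong; Span)
  open Module H using () renaming
    (Carrierᴹ to 𝕜T; _≈ᴹ_ to _≈_; _+ᴹ_ to _⊕_; _*ₗ_ to _⊛_; -ᴹ_ to ⊖_)
  open Module H⊗H using () renaming (_+ᴹ_ to _⊕⊗_; 0ᴹ to 𝟎⊗)
  private
    module H = Module H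

  Ladders : Pred 𝕜T _
  Ladders = GeneratedSubalgebra PlantedTallElement

  ForestSpan : Pred 𝕜T _
  ForestSpan = Span H (λ u → ∃ λ t → TallForest t × u ≡ [ t ])

  tallForest⇒ladders : ∀ {t} → TallForest t → Ladders [ t ]
  tallForest⇒ladders (node [])                  = 1-closed
  tallForest⇒ladders (node {(c , _) ∷ _} (h ∷ hs)) =
    -- The product of two basis elements computes to the basis element of their concatenation, so
    -- splitting off the first branch holds by definition.
    ∙-closed (gen (_ , B⁺-plantedTall c h , refl)) (tallForest⇒ladders (node hs))

  ∙-congʳ : ∀ {u u′} v → u ≈ u′ → u ∙ v ≈ u′ ∙ v
  ∙-congʳ v eq = extend-cong H _ (extend-cong H⊗H _ eq)

  -- With a basis tree on the left, the product unfolds to a linear extension in `v`. This is the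
  -- case that arises once `forestSpan-∙` has reduced its left factor to a generator.
  [-]∙-cong : ∀ s {v v′} → v ≈ v′ → [ s ] ∙ v ≈ [ s ] ∙ v′
  [-]∙-cong s eq = extend-cong H _ (extend-cong H⊗H _ eq)

  ∙-identityʳ : ∀ u → u ∙ 𝟏 ≈ u
  ∙-identityʳ [ t ]           = H.≈ᴹ-reflexive (cong [_] (·-identityʳ t))
  ∙-identityʳ 𝟎               = H.≈ᴹ-refl
  ∙-identityʳ (u Linear.+ v)  = H.+ᴹ-cong (∙-identityʳ u) (∙-identityʳ v)
  ∙-identityʳ (k Linear.* u)  = H.*ₗ-cong (CommutativeRing.refl 𝕜) (∙-identityʳ u)

  forestSpan-[-]∙ : ∀ {s v} → TallForest s → ForestSpan v → ForestSpan ([ s ] ∙ v)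
  forestSpan-[-]∙ h (Span.gen (_ , k , refl)) = Span.gen (_ , ·-tallForest h k , refl)
  forestSpan-[-]∙ h (Span.resp eq v)          = Span.resp ([-]∙-cong _ eq) (forestSpan-[-]∙ h v)
  forestSpan-[-]∙ h Span.0-closed             = Span.0-closed
  forestSpan-[-]∙ h (Span.+-closed v w)       =
    Span.+-closed (forestSpan-[-]∙ h v) (forestSpan-[-]∙ h w)
  forestSpan-[-]∙ h (Span.*ₗ-closed k v)      = Span.*ₗ-closed k (forestSpan-[-]∙ h v)

  forestSpan-∙ : ∀ {u v} → ForestSpan u → ForestSpan v → ForestSpan (u ∙ v)
  forestSpan-∙ (Span.gen (_ , h , refl)) w = forestSpan-[-]∙ h w
  forestSpan-∙ {v = v} (Span.resp eq u) w  = Span.resp (∙-congʳ v eq) (forestSpan-∙ u w)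
  forestSpan-∙ Span.0-closed w             = Span.0-closed
  forestSpan-∙ (Span.+-closed u u′) w      = Span.+-closed (forestSpan-∙ u w) (forestSpan-∙ u′ w)
  forestSpan-∙ (Span.*ₗ-closed k u) w      = Span.*ₗ-closed k (forestSpan-∙ u w)

  -- The product case carries the content: concatenating two forests of ladders gives another, and
  -- bilinearity extends this to the spans.
  ladders⇒forestSpan : ∀ {u} → Ladders u → ForestSpan u
  ladders⇒forestSpan (gen (_ , h , refl)) =
    Span.gen (_ , tall⇒tallForest (plantedTall⇒tall h) , refl)
  ladders⇒forestSpan (resp eq u)     = Span.resp eq (ladders⇒forestSpan u)
  ladders⇒forestSpan 0-closed        = Span.0-closed
  ladders⇒forestSpan (+-closed u v)  = Span.+-closed (ladders⇒forestSpan u) (ladders⇒forestSpan v)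
  ladders⇒forestSpan (*ₗ-closed k u) = Span.*ₗ-closed k (ladders⇒forestSpan u)
  ladders⇒forestSpan 1-closed        = Span.gen (_ , node [] , refl)
  ladders⇒forestSpan (∙-closed u v)  = forestSpan-∙ (ladders⇒forestSpan u) (ladders⇒forestSpan v)

  -- Closure under the coproduct.

  Δ-tallForest : ∀ {t} → TallForest t → TensorSquare Ladders (Δ [ t ])
  Δ-tallForest {t} h = terms (admissibleSubtrees t)
    where
    terms : (ps : List (AdmissibleSubtree t)) → TensorSquare Ladders
      (foldr (λ p w → [ complement p , subtree p ] ⊕⊗ w) 𝟎⊗ ps)
    terms []       = Span.0-closed
    terms (p ∷ ps) = Span.+-closed
      -- The tensor of two basis elements computes to the basis element of the pair, so `refl`
      -- identifies it with the summand.
      (Span.gen (_ , _ , tallForest⇒ladders (complement-tallForest h p)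
                       , tallForest⇒ladders (subtree-tallForest h p) , refl))
      (terms ps)

  -- In `ForestSpan` products are already absorbed into the basis trees, so the cases beyond the
  -- generators are those of linearity and of `≈`.
  Δ-forestSpan : ∀ {u} → ForestSpan u → TensorSquare Ladders (Δ u)
  Δ-forestSpan (Span.gen (_ , h , refl)) = Δ-tallForest h
  Δ-forestSpan (Span.resp eq u)          = Span.resp (extend-cong H⊗H _ eq) (Δ-forestSpan u)
  Δ-forestSpan Span.0-closed             = Span.0-closed
  Δ-forestSpan (Span.+-closed u v)       = Span.+-closed (Δ-forestSpan u) (Δ-forestSpan v)
  Δ-forestSpan (Span.*ₗ-closed k u)      = Span.*ₗ-closed k (Δ-forestSpan u)

  -- Closure under the antipode.

  ladders-+-cancelʳ : ∀ {u v w} → u ⊕ v ≈ w → Ladders v → Ladders w → Ladders u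
  ladders-+-cancelʳ {u} {v} {w} eq hv hw =
    resp (H.≈ᴹ-trans (H.+ᴹ-cong (H.≈ᴹ-sym eq) H.≈ᴹ-refl)
         (H.≈ᴹ-trans (H.+ᴹ-assoc u v (⊖ v))
         (H.≈ᴹ-trans (H.+ᴹ-cong H.≈ᴹ-refl (H.-ᴹ‿inverseʳ v)) (H.+ᴹ-identityʳ u))))
      -- In this module `⊖ v` is the multiple of `v` by minus one, so closure under scalars covers
      -- it.
      (+-closed hw (*ₗ-closed _ hv))

  module _ {S : 𝕜T → 𝕜T} (antipode : IsAntipode S) where

    open IsAntipode antipode
    open IsModuleHomomorphism isModuleHomomorphism

    -- The list is arbitrary: on the full enumeration this is the left side of `inverseˡ`, and on
    -- its tail it is what remains after splitting off the trivial subtree.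
    convolution : ∀ {t} → List (AdmissibleSubtree t) → 𝕜T
    convolution ps = μ (map⊗ S id (foldr (λ p w → [ complement p , subtree p ] ⊕⊗ w) 𝟎⊗ ps))

    convolution-ladders : ∀ {t} → TallForest t → {ps : List (AdmissibleSubtree t)} →
                          All (Ladders ∘ S ∘ [_] ∘ complement) ps → Ladders (convolution ps)
    convolution-ladders h []                = 0-closed
    convolution-ladders h (_∷_ {x = p} k ks) =
      +-closed (∙-closed k (tallForest⇒ladders (subtree-tallForest h p)))
               (convolution-ladders h ks)

    antipode-tallForest-acc : ∀ {t} → Acc _<_ (edges t) → TallForest t → Ladders (S [ t ])
    antipode-tallForest-acc {t} (acc smaller) h
      -- Abstracting all four together lets the split of the enumeration into head and tail act on
      -- the uniqueness proof and the antipode identity as well. Uniqueness then says that every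
      -- entry of `ps` differs from the trivial subtree.
      with admissibleSubtrees t | admissibleSubtrees-head t | admissibleSubtrees-unique t
         | inverseˡ [ t ]
    ... | _ | ps , refl | nontrivial AllPairs.∷ _ | identity =
      -- The head term of the convolution is `S [ t ] ∙ 𝟏`, up to the equations for the trivial
      -- subtree.
      resp (H.≈ᴹ-trans (H.≈ᴹ-reflexive (cong₂ (λ s r → S [ s ] ∙ [ r ])
              (complement-trivialSubtree t) (subtree-trivialSubtree t)))
            (∙-identityʳ (S [ t ])))
        (ladders-+-cancelʳ identity
          -- Each remaining subtree is non-trivial, so its complement has fewer edges than `t` and
          -- the induction hypothesis applies.
          (convolution-ladders h (All.map (λ {p} ≢p →
            antipode-tallForest-acc (smaller (complement-< p ≢p)) (complement-tallForest h p))
            nontrivial))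
          (*ₗ-closed _ 1-closed))

    antipode-forestSpan : ∀ {u} → ForestSpan u → Ladders (S u)
    antipode-forestSpan (Span.gen (t , h , refl)) =
      antipode-tallForest-acc (<-wellFounded (edges t)) h
    antipode-forestSpan (Span.resp eq u)     = resp (⟦⟧-cong eq) (antipode-forestSpan u)
    antipode-forestSpan Span.0-closed        = resp (H.≈ᴹ-sym 0ᴹ-homo) 0-closed
    antipode-forestSpan (Span.+-closed u v)  =
      resp (H.≈ᴹ-sym (+ᴹ-homo _ _)) (+-closed (antipode-forestSpan u) (antipode-forestSpan v))
    antipode-forestSpan (Span.*ₗ-closed k u) =
      resp (H.≈ᴹ-sym (*ₗ-homo k _)) (*ₗ-closed k (antipode-forestSpan u))

proposition3p3 : ∀ {c ℓ₁ ℓ₂ a} (K : HeytingField c ℓ₁ ℓ₂) → CharacteristicZero K →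
    (A : Set a) {n : ℕ} → A ↔ Fin n →
    let open TreeHopfAlgebra K A in
    IsHopfSubalgebra (GeneratedSubalgebra PlantedTallElement)
proposition3p3 K _ A _ = record
  { isSubmodule = record
    { resp = resp ; 0-closed = 0-closed ; +-closed = +-closed ; *ₗ-closed = *ₗ-closed }
  ; 1-closed    = 1-closed
  ; ∙-closed    = ∙-closed
  ; Δ-closed    = Δ-forestSpan K A ∘ ladders⇒forestSpan K A
  ; S-closed    = λ antipode → antipode-forestSpan K A antipode ∘ ladders⇒forestSpan K A
  }
  where open TreeHopfAlgebra K A
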